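{- Let $G$ be a connected graph with $n$ vertices and minimum degree $k$. Then there exists a connected subgraph $H$ of $G$ with at most $3\lfloor n/(k+1)\rfloor-2$ vertices such that every vertex of $G$ is at distance at most $2$ (in $G$) from $H$.
   Context: Graphs are finite, simple, undirected and have at least one vertex; a connected subgraph is understood to be nonempty. The distance in $G$ from a vertex $v$ to a subgraph $H$ is the minimum, over vertices $u$ of $H$, of the graph distance in $G$ between $v$ and $u$. -}

module Defs where

open import Data.Fin using (Fin)
open import Data.Fin.Subset using (Subset; Nonempty; _∈_; ∣_∣)
open import Data.Nat using (ℕ; zero; suc; _≤_; NonZero)
open import Data.Product using (∃-syntax; _×_)
open import Data.Vec using (tabulate)
open import Level using (0ℓ)
open import Relation.Binary using (Rel; Decidable; Symmetric; Irreflexive)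
open import Relation.Binary.PropositionalEquality using (_≡_)
open import Relation.Nullary using (does)

-- Vertices are labelled by Fin n.  Decidability of adjacency is part of the
-- data: it is what makes the graph a finite object constructively.
record Graph (n : ℕ) : Set₁ where
  field
    nonEmpty : NonZero n
    Adj      : Rel (Fin n) 0ℓ
    adj?     : Decidable Adj
    sym      : Symmetric Adj
    irrefl   : Irreflexive _≡_ Adj

-- Walks indexed by their number of edges.
data Walk {n : ℕ} (R : Rel (Fin n) 0ℓ) : ℕ → Rel (Fin n) 0ℓ where
  []  : ∀ {u} → Walk R zero u u
  _∷_ : ∀ {l u v w} → R u v → Walk R l v w → Walk R (suc l) u w

module _ {n : ℕ} (G : Graph n) where
  open Graph G

  Connected : Set
  Connected = ∀ u v → ∃[ l ] Walk Adj l u v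

  neighbours : Fin n → Subset n
  neighbours v = tabulate (λ u → does (adj? v u))

  degree : Fin n → ℕ
  degree v = ∣ neighbours v ∣

  -- The minimum is attained, so k is determined by G.
  MinDegree : ℕ → Set
  MinDegree k = (∀ v → k ≤ degree v) × (∃[ v ] degree v ≡ k)

  -- An arbitrary subgraph, not necessarily induced.
  record Subgraph : Set₁ where
    field
      vertices : Subset n
      Edge     : Rel (Fin n) 0ℓ
      edge?    : Decidable Edge
      edgeSym  : Symmetric Edge
      edge⇒adj : ∀ {u v} → Edge u v → Adj u v
      -- With edgeSym, both endpoints lie in the vertex set.
      edge⇒∈   : ∀ {u v} → Edge u v → u ∈ vertices

  open Subgraph

  order : Subgraph → ℕ
  order H = ∣ vertices H ∣

  ConnectedSubgraph : Subgraph → Set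
  ConnectedSubgraph H =
    Nonempty (vertices H) ×
    (∀ u v → u ∈ vertices H → v ∈ vertices H → ∃[ l ] Walk (Edge H) l u v)

  -- Distances are given as relations, since the distance is only defined
  -- between vertices that are joined by a walk.
  IsDistance : Fin n → Fin n → ℕ → Set
  IsDistance u v d = Walk Adj d u v × (∀ l → Walk Adj l u v → d ≤ l)

  IsDistanceTo : Fin n → Subgraph → ℕ → Set
  IsDistanceTo v H d =
    (∃[ u ] u ∈ vertices H × IsDistance v u d) ×
    (∀ u e → u ∈ vertices H → IsDistance v u e → d ≤ e)

{-# OPTIONS --safe #-}
-- Grow a connected vertex set S together with a union U of m pairwise disjoint
-- closed neighbourhoods of vertices of S, keeping ∣S∣ ≤ 3m − 2.  If some vertex
-- is at distance more than 2 from S, then by connectedness some x is at distance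
-- exactly 3.  The closed neighbourhood of x is disjoint from U, and adding x and
-- the two inner vertices of a shortest walk from x to S increases m by one.
-- Since every closed neighbourhood has at least k + 1 vertices, m ≤ ⌊n/(k+1)⌋.
module Submission where

open import Data.Bool using (true; false)
open import Data.Fin using (Fin)
open import Data.Fin.Properties using (_≟_; any?; all?; ¬∀⟶∃¬)
open import Data.Fin.Subset using (Subset; Empty; _∈_; _⊆_; ∣_∣; ⁅_⁆; _∪_; _∩_)
open import Data.Fin.Subset.Properties
  using (_∈?_; x∈⁅x⁆; x∈⁅y⁆⇒x≡y; ∣⁅x⁆∣≡1; ∣p∣≤n; p⊆p∪q; q⊆p∪q; x∈p∪q⁻; x∈p∩q⁻; Empty-unique; ∣⊥∣≡0)
open import Data.Nat using (ℕ; zero; suc; _+_; _*_; _∸_; _≤_; _<_; z≤n; s≤s; s≤s⁻¹)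
open import Data.Nat.DivMod using (_/_; m*n/n≡m; /-monoˡ-≤)
open import Data.Nat.Properties hiding (_≟_)
open import Data.Product using (∃-syntax; _×_; _,_)
open import Data.Sum using (inj₁; inj₂)
open import Data.Vec using ([]; _∷_)
open import Data.Vec.Properties using (lookup∘tabulate; []=⇒lookup)
open import Level using (0ℓ)
open import Relation.Binary using (Rel; Decidable; Symmetric)
open import Relation.Binary.PropositionalEquality using (_≡_; refl; sym; trans; cong; subst)
open import Relation.Nullary using (yes; no; ¬_; contradiction)
open import Relation.Nullary.Decidable using (map′; _×-dec_)
import Relation.Unary as Unary
open import Defs

-- Cardinalities of unions of finite sets.

∣p∪q∣+∣p∩q∣≡∣p∣+∣q∣ : ∀ {n} (p q : Subset n) → ∣ p ∪ q ∣ + ∣ p ∩ q ∣ ≡ ∣ p ∣ + ∣ q ∣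
∣p∪q∣+∣p∩q∣≡∣p∣+∣q∣ []          []          = refl
∣p∪q∣+∣p∩q∣≡∣p∣+∣q∣ (false ∷ p) (false ∷ q) = ∣p∪q∣+∣p∩q∣≡∣p∣+∣q∣ p q
∣p∪q∣+∣p∩q∣≡∣p∣+∣q∣ (true  ∷ p) (false ∷ q) = cong suc (∣p∪q∣+∣p∩q∣≡∣p∣+∣q∣ p q)
∣p∪q∣+∣p∩q∣≡∣p∣+∣q∣ (false ∷ p) (true  ∷ q) =
  trans (cong suc (∣p∪q∣+∣p∩q∣≡∣p∣+∣q∣ p q)) (sym (+-suc ∣ p ∣ ∣ q ∣))
∣p∪q∣+∣p∩q∣≡∣p∣+∣q∣ (true  ∷ p) (true  ∷ q) = cong suc
  (trans (+-suc _ _) (trans (cong suc (∣p∪q∣+∣p∩q∣≡∣p∣+∣q∣ p q)) (sym (+-suc ∣ p ∣ ∣ q ∣))))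

∣p∪q∣≡∣p∣+∣q∣ : ∀ {n} (p q : Subset n) → Empty (p ∩ q) → ∣ p ∪ q ∣ ≡ ∣ p ∣ + ∣ q ∣
∣p∪q∣≡∣p∣+∣q∣ {n} p q disjoint = trans (sym (+-identityʳ _))
  (trans (cong (∣ p ∪ q ∣ +_) (sym (trans (cong ∣_∣ (Empty-unique disjoint)) (∣⊥∣≡0 n))))
         (∣p∪q∣+∣p∩q∣≡∣p∣+∣q∣ p q))

∣p∪⁅x⁆∣≤1+∣p∣ : ∀ {n} (p : Subset n) x → ∣ p ∪ ⁅ x ⁆ ∣ ≤ suc ∣ p ∣
∣p∪⁅x⁆∣≤1+∣p∣ p x = begin
  ∣ p ∪ ⁅ x ⁆ ∣                     ≤⟨ m≤m+n _ _ ⟩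
  ∣ p ∪ ⁅ x ⁆ ∣ + ∣ p ∩ ⁅ x ⁆ ∣     ≡⟨ ∣p∪q∣+∣p∩q∣≡∣p∣+∣q∣ p ⁅ x ⁆ ⟩
  ∣ p ∣ + ∣ ⁅ x ⁆ ∣                 ≡⟨ cong (∣ p ∣ +_) (∣⁅x⁆∣≡1 x) ⟩
  ∣ p ∣ + 1                         ≡⟨ +-comm ∣ p ∣ 1 ⟩
  suc ∣ p ∣                         ∎
  where open ≤-Reasoning

-- Turns the length of some walk into a shortest length: the search ascends from zero, and the known
-- witness makes it end.
least : ∀ {P : ℕ → Set} → Unary.Decidable P → ∀ {n} → P n →
  ∃[ m ] (m ≤ n × P m × (∀ l → P l → m ≤ l))
least P? {zero}  p = zero , z≤n , p , λ _ _ → z≤n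
least P? {suc n} p with P? zero
... | yes p₀ = zero , z≤n , p₀ , λ _ _ → z≤n
... | no ¬p₀ with m , m≤n , pₘ , min ← least (λ l → P? (suc l)) p =
  suc m , s≤s m≤n , pₘ , λ where
    zero    p₀ → contradiction p₀ ¬p₀
    (suc l) pₗ → s≤s (min l pₗ)

-- Walks.

module _ {n : ℕ} {R : Rel (Fin n) 0ℓ} where

  _++_ : ∀ {l m u v w} → Walk R l u v → Walk R m v w → Walk R (l + m) u w
  []      ++ q = q
  (e ∷ p) ++ q = e ∷ (p ++ q)

  reverse : Symmetric R → ∀ {l u v} → Walk R l u v → ∃[ m ] Walk R m v u
  reverse R-sym []      = zero , []
  reverse R-sym (e ∷ p) with _ , q ← reverse R-sym p = _ , q ++ (R-sym e ∷ [])

  -- With the length fixed, only finitely many next vertices need to be tried at each step. The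
  -- later case splits on distance to a set rest on this.
  walk? : Decidable R → ∀ l → Decidable (Walk R l)
  walk? R? zero    u v = map′ (λ { refl → [] }) (λ { [] → refl }) (u ≟ v)
  walk? R? (suc l) u v = map′ (λ { (_ , e , p) → e ∷ p }) (λ { (e ∷ p) → _ , e , p })
    (any? (λ w → R? u w ×-dec walk? R? l w v))

mapWalk : ∀ {n} {R Q : Rel (Fin n) 0ℓ} → (∀ {u v} → R u v → Q u v) →
  ∀ {l u v} → Walk R l u v → Walk Q l u v
mapWalk f []      = []
mapWalk f (e ∷ p) = f e ∷ mapWalk f p

-- Closed neighbourhoods.

module _ {n : ℕ} (G : Graph n) where
  open Graph G using (Adj; adj?; irrefl) renaming (sym to adj-sym)

  ∈neighbours⇒adj : ∀ {u v} → u ∈ neighbours G v → Adj v u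
  ∈neighbours⇒adj {u} {v} u∈N with adj? v u | trans (sym (lookup∘tabulate _ u)) ([]=⇒lookup u∈N)
  ... | yes e | _  = e
  ... | no _  | ()

  closedNeighbours : Fin n → Subset n
  closedNeighbours v = ⁅ v ⁆ ∪ neighbours G v

  ∣closedNeighbours∣ : ∀ v → ∣ closedNeighbours v ∣ ≡ suc (degree G v)
  ∣closedNeighbours∣ v = trans (∣p∪q∣≡∣p∣+∣q∣ ⁅ v ⁆ (neighbours G v) disjoint)
    (cong (_+ degree G v) (∣⁅x⁆∣≡1 v))
    where
    disjoint : Empty (⁅ v ⁆ ∩ neighbours G v)
    disjoint (u , u∈) with u∈v , u∈N ← x∈p∩q⁻ ⁅ v ⁆ _ u∈ =
      irrefl (sym (x∈⁅y⁆⇒x≡y v u∈v)) (∈neighbours⇒adj u∈N)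

  -- Connected vertex sets.

  induced : Subset n → Subgraph G
  induced S = record
    { vertices = S
    ; Edge     = λ u v → Adj u v × u ∈ S × v ∈ S
    ; edge?    = λ u v → adj? u v ×-dec (u ∈? S ×-dec v ∈? S)
    ; edgeSym  = λ (e , u∈S , v∈S) → adj-sym e , v∈S , u∈S
    ; edge⇒adj = λ (e , _ , _) → e
    ; edge⇒∈   = λ (_ , u∈S , _) → u∈S
    }

  ConnectedSet : Subset n → Set
  ConnectedSet S = ConnectedSubgraph G (induced S)

  connected-⁅⁆ : ∀ v → ConnectedSet ⁅ v ⁆
  connected-⁅⁆ v = (v , x∈⁅x⁆ v) , λ x y x∈ y∈ →
    zero , subst (Walk _ zero x) (trans (x∈⁅y⁆⇒x≡y v x∈) (sym (x∈⁅y⁆⇒x≡y v y∈))) []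

  -- `s` serves as a hub: every vertex of the enlarged set has a walk to it, and one such walk
  -- followed by the reverse of another joins any two vertices.
  connected-∪⁅⁆ : ∀ {S s v} → ConnectedSet S → s ∈ S → Adj v s → ConnectedSet (S ∪ ⁅ v ⁆)
  connected-∪⁅⁆ {S} {s} {v} (_ , conn) s∈S e = (s , S⊆S′ s∈S) , walk
    where
    S′ = S ∪ ⁅ v ⁆
    open Subgraph (induced S′) using (Edge; edgeSym)

    S⊆S′ : S ⊆ S′
    S⊆S′ = p⊆p∪q ⁅ v ⁆

    walkTo-s : ∀ u → u ∈ S′ → ∃[ l ] Walk Edge l u s
    walkTo-s u u∈S′ with x∈p∪q⁻ S ⁅ v ⁆ u∈S′
    ... | inj₁ u∈S with l , p ← conn u s u∈S s∈S =
      l , mapWalk (λ (a , x∈S , y∈S) → a , S⊆S′ x∈S , S⊆S′ y∈S) p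
    ... | inj₂ u∈v rewrite x∈⁅y⁆⇒x≡y v u∈v =
      1 , (e , q⊆p∪q S ⁅ v ⁆ (x∈⁅x⁆ v) , S⊆S′ s∈S) ∷ []

    walk : ∀ x y → x ∈ S′ → y ∈ S′ → ∃[ l ] Walk Edge l x y
    walk x y x∈S′ y∈S′ with _ , p ← walkTo-s x x∈S′ | _ , q ← walkTo-s y y∈S′
      with _ , q⁻¹ ← reverse edgeSym q = _ , p ++ q⁻¹

  -- Distance from a vertex to a set.

  Reach : Subset n → ℕ → Fin n → Set
  Reach S d v = ∃[ u ] (u ∈ S × Walk Adj d v u)

  reach? : ∀ S d → Unary.Decidable (Reach S d)
  reach? S d v = any? (λ u → u ∈? S ×-dec walk? adj? d v u)

  -- The bound is strict, as in a bounded search, so distance at most 2 appears as `Within S 3`.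
  Within : Subset n → ℕ → Fin n → Set
  Within S e v = ∃[ d ] (d < e × Reach S d v)

  within? : ∀ S e → Unary.Decidable (Within S e)
  within? S e v = anyUpTo? (λ d → reach? S d v) e

  within-mono : ∀ {S T e v} → S ⊆ T → Within S e v → Within T e v
  within-mono S⊆T (d , d<e , u , u∈S , p) = d , d<e , u , S⊆T u∈S , p

  closedNeighbours⊆within : ∀ {S v u} → v ∈ S → u ∈ closedNeighbours v → Within S 2 u
  closedNeighbours⊆within {S} {v} v∈S u∈ with x∈p∪q⁻ ⁅ v ⁆ _ u∈
  ... | inj₁ u∈v rewrite x∈⁅y⁆⇒x≡y v u∈v = 0 , s≤s z≤n , v , v∈S , []
  ... | inj₂ u∈N = 1 , s≤s (s≤s z≤n) , v , v∈S , adj-sym (∈neighbours⇒adj u∈N) ∷ []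

  -- One more edge costs one more step. Hence the closed neighbourhood of a vertex beyond distance 2
  -- misses everything within distance 1 of `S`.
  within-closedNeighbours : ∀ {S e v u} → u ∈ closedNeighbours v → Within S e u → Within S (suc e) v
  within-closedNeighbours {v = v} u∈ (d , d<e , s , s∈S , p) with x∈p∪q⁻ ⁅ v ⁆ _ u∈
  ... | inj₁ u∈v rewrite x∈⁅y⁆⇒x≡y v u∈v = d , m≤n⇒m≤1+n d<e , s , s∈S , p
  ... | inj₂ u∈N = suc d , s≤s d<e , s , s∈S , ∈neighbours⇒adj u∈N ∷ p

  -- The least length of a walk from `v` into `H` is both the distance to the endpoint attaining it
  -- and a lower bound for the distance to every vertex of `H`.
  within⇒distance : ∀ {e v} H → Within (Subgraph.vertices H) (suc e) v →
    ∃[ d ] (IsDistanceTo G v H d × d ≤ e)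
  within⇒distance {v = v} H (d , d<1+e , r)
    with m , m≤d , (u , u∈H , p) , min ← least (λ l → reach? (Subgraph.vertices H) l v) r =
    m , ((u , u∈H , p , λ l q → min l (u , u∈H , q)) , λ w l w∈H (q , _) → min l (w , w∈H , q))
      , ≤-trans m≤d (s≤s⁻¹ d<1+e)

  -- x is the last vertex before the walk first enters Within S (suc e).
  boundary : ∀ {S e l v s} → s ∈ S → Walk Adj l v s → ¬ Within S (suc e) v →
    ∃[ x ] (¬ Within S (suc e) x × Reach S (suc e) x)
  boundary {s = s} s∈S [] far = contradiction (0 , s≤s z≤n , s , s∈S , []) far
  boundary {S} {e} {v = v} s∈S (_∷_ {v = w} a p) far with within? S (suc e) w
  ... | no far′ = boundary s∈S p far′
  -- If `d < e`, the edge `a` would bring `v` itself inside; so `d` equals `e`, and prepending `a`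
  -- gives a walk of exactly `suc e` edges.
  ... | yes (d , d<1+e , u , u∈S , q) with m≤n⇒m<n∨m≡n (s≤s⁻¹ d<1+e)
  ...   | inj₁ d<e  = contradiction (suc d , s≤s d<e , u , u∈S , a ∷ q) far
  ...   | inj₂ refl = v , far , u , u∈S , a ∷ q

  -- Growing a packing of closed neighbourhoods.

  module _ {k : ℕ} (k≤degree : ∀ v → k ≤ degree G v) where

    -- The disjoint neighbourhoods are remembered only through their union `U` and its size. Adding
    -- 2 on the left of `∣S∣-bound` avoids truncated subtraction.
    record Packing (m : ℕ) : Set where
      field
        S U       : Subset n
        connected : ConnectedSet S
        ∣S∣-bound : 2 + ∣ S ∣ ≤ 3 * m
        ∣U∣-bound : m * suc k ≤ ∣ U ∣
        U-within  : ∀ {u} → u ∈ U → Within S 2 u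

    k<∣closedNeighbours∣ : ∀ v → suc k ≤ ∣ closedNeighbours v ∣
    k<∣closedNeighbours∣ v = subst (suc k ≤_) (sym (∣closedNeighbours∣ v)) (s≤s (k≤degree v))

    singleton : Fin n → Packing 1
    singleton v = record
      { S         = ⁅ v ⁆
      ; U         = closedNeighbours v
      ; connected = connected-⁅⁆ v
      ; ∣S∣-bound = ≤-reflexive (cong (2 +_) (∣⁅x⁆∣≡1 v))
      ; ∣U∣-bound = subst (_≤ ∣ closedNeighbours v ∣) (sym (*-identityˡ (suc k))) (k<∣closedNeighbours∣ v)
      ; U-within  = closedNeighbours⊆within (x∈⁅x⁆ v)
      }

    extend : ∀ {m} (P : Packing m) {x} →
      ¬ Within (Packing.S P) 3 x → Reach (Packing.S P) 3 x → Packing (suc m)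
    extend {m} P {x} far (s , s∈S , _∷_ {v = a} xa (_∷_ {v = b} ab (bs ∷ []))) = record
      { S         = S₃
      ; U         = U ∪ closedNeighbours x
      -- Vertices are added outwards from `S`, in the order `b`, `a`, `x`, so each is adjacent to
      -- one already present.
      ; connected = connected-∪⁅⁆ (connected-∪⁅⁆ (connected-∪⁅⁆ connected s∈S bs)
                      (q⊆p∪q S ⁅ b ⁆ (x∈⁅x⁆ b)) ab) (q⊆p∪q S₁ ⁅ a ⁆ (x∈⁅x⁆ a)) xa
      ; ∣S∣-bound = S-bound
      ; ∣U∣-bound = U-bound
      ; U-within  = within
      }
      where
      open Packing P
      S₁ = S ∪ ⁅ b ⁆
      S₂ = S₁ ∪ ⁅ a ⁆
      S₃ = S₂ ∪ ⁅ x ⁆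

      S-bound : 2 + ∣ S₃ ∣ ≤ 3 * suc m
      S-bound = begin
        2 + ∣ S₃ ∣             ≤⟨ +-monoʳ-≤ 2 (∣p∪⁅x⁆∣≤1+∣p∣ S₂ x) ⟩
        3 + ∣ S₂ ∣             ≤⟨ +-monoʳ-≤ 3 (∣p∪⁅x⁆∣≤1+∣p∣ S₁ a) ⟩
        4 + ∣ S₁ ∣             ≤⟨ +-monoʳ-≤ 4 (∣p∪⁅x⁆∣≤1+∣p∣ S b) ⟩
        3 + (2 + ∣ S ∣)        ≤⟨ +-monoʳ-≤ 3 ∣S∣-bound ⟩
        3 + 3 * m              ≡⟨ sym (*-suc 3 m) ⟩
        3 * suc m              ∎
        where open ≤-Reasoning

      disjoint : Empty (U ∩ closedNeighbours x)
      -- A common vertex would be within distance 1 of both `S` and `x`, placing `x` within distance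
      -- 2 of `S`.
      disjoint (u , u∈) with u∈U , u∈N ← x∈p∩q⁻ U _ u∈ =
        far (within-closedNeighbours u∈N (U-within u∈U))

      U-bound : suc m * suc k ≤ ∣ U ∪ closedNeighbours x ∣
      U-bound = begin
        suc k + m * suc k                ≤⟨ +-mono-≤ (k<∣closedNeighbours∣ x) ∣U∣-bound ⟩
        ∣ closedNeighbours x ∣ + ∣ U ∣   ≡⟨ +-comm _ ∣ U ∣ ⟩
        ∣ U ∣ + ∣ closedNeighbours x ∣   ≡⟨ sym (∣p∪q∣≡∣p∣+∣q∣ U _ disjoint) ⟩
        ∣ U ∪ closedNeighbours x ∣       ∎
        where open ≤-Reasoning

      within : ∀ {u} → u ∈ U ∪ closedNeighbours x → Within S₃ 2 u
      within u∈ with x∈p∪q⁻ U _ u∈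
      ... | inj₁ u∈U = within-mono
        (λ y∈S → p⊆p∪q ⁅ x ⁆ (p⊆p∪q ⁅ a ⁆ (p⊆p∪q ⁅ b ⁆ y∈S))) (U-within u∈U)
      ... | inj₂ u∈N = closedNeighbours⊆within (q⊆p∪q S₂ ⁅ x ⁆ (x∈⁅x⁆ x)) u∈N

    packing-bound : ∀ {m} → Packing m → m * suc k ≤ n
    packing-bound P = ≤-trans (Packing.∣U∣-bound P) (∣p∣≤n (Packing.U P))

    -- Since `m` blocks of size `suc k` fit into `n`, `m` is at most the quotient; subtracting 2
    -- from `2 + ∣ S ∣` computes to `∣ S ∣`.
    order-bound : ∀ {m} (P : Packing m) → ∣ Packing.S P ∣ ≤ 3 * (n / suc k) ∸ 2
    order-bound {m} P = ∸-monoˡ-≤ 2 (≤-trans (Packing.∣S∣-bound P) (*-monoʳ-≤ 3 m≤n/1+k))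
      where
      m≤n/1+k : m ≤ n / suc k
      m≤n/1+k = subst (_≤ n / suc k) (m*n/n≡m m (suc k)) (/-monoˡ-≤ (suc k) (packing-bound P))

    -- `f` is fuel: each extension raises `m` by one and preserves `n < f + m`. At zero fuel this
    -- would contradict `m ≤ m * suc k ≤ n`.
    dominating : Connected G → ∀ f {m} → n < f + m → Packing m →
      ∃[ m′ ] ∃[ P ] (∀ v → Within (Packing.S {m′} P) 3 v)
    dominating _ zero {m} n<m P =
      contradiction (≤-trans (m≤m*n m (suc k)) (packing-bound P)) (<⇒≱ n<m)
    dominating conn (suc f) {m} n<f+m P with all? (within? (Packing.S P) 3)
    ... | yes all = m , P , all
    ... | no ¬all with v , far ← ¬∀⟶∃¬ n _ (within? (Packing.S P) 3) ¬all
                  with (s , s∈S) , _ ← Packing.connected P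
                  with _ , p ← conn v s
                  with _ , far′ , r ← boundary s∈S p far =
      dominating conn f (subst (n <_) (sym (+-suc f m)) n<f+m) (extend P far′ r)

lemma1p2 : ∀ (n k : ℕ) (G : Graph n) → Connected G → MinDegree G k →
    ∃[ H ] (ConnectedSubgraph G H × order G H ≤ 3 * (n / suc k) ∸ 2 ×
    (∀ v → ∃[ d ] (IsDistanceTo G v H d × d ≤ 2)))
lemma1p2 n k G conn (k≤degree , v , _)
  -- The vertex attaining the minimum degree is the first centre; fuel `n` suffices because the
  -- initial packing has `m` equal to 1.
  with m , P , all ← dominating G k≤degree conn n (m<m+n n (s≤s z≤n)) (singleton G k≤degree v) =
  induced G (S P) , connected P , order-bound G k≤degree P , λ v → within⇒distance G (induced G (S P)) (all v)
  where open Packing
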